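{- Let $\mathbf{r}=(r_0,r_1)\in\mathbb{R}^2$. If $\tau_{\mathbf{r}}$ has a cycle of alternating signs, then $|r_0-r_1+1|<\frac12$. Furthermore, $\tau_{\mathbf{r}}$ has a cycle of the form $(t,-t)$ for some $t\in\mathbb{Z}\setminus\{0\}$ if and only if $r_0-r_1+1=0$. Thus, $\{(r_0,r_0+1)\mid r_0\in\mathbb{R}\}$ has empty intersection with $\mathcal{D}_2^{(*)}$.
   Context: For $\mathbf{r}=(r_0,r_1)\in\mathbb{R}^2$, the two-dimensional shift radix system is the map $\tau_{\mathbf{r}}:\mathbb{Z}^2\to\mathbb{Z}^2$, $\tau_{\mathbf{r}}(a_0,a_1)=(a_1,-\lfloor r_0a_0+r_1a_1\rfloor)$. The orbit of $(a_0,a_1)$ is identified with the integer sequence $(a_n)_{n\ge 0}$ where $a_{n+2}=-\lfloor r_0a_n+r_1a_{n+1}\rfloor$ for $n\ge0$. An orbit is ultimately periodic if there are $n_0\ge 0$, $p>0$ with $a_{n+p}=a_n$ for all $n\ge n_0$; in this case $(a_n,\ldots,a_{n+p-1})$ with $n\ge n_0$ is called a cycle of $\tau_{\mathbf{r}}$. A cycle $(a_0,\ldots,a_{p-1})$ has alternating signs if $a_ia_{i+1}<0$ for all $i\in\{0,\ldots,p-1\}$, where $a_p=a_0$. $\mathcal{D}_2^{(*)}$ is the set of all $\mathbf{r}\in\mathbb{R}^2$ such that each ultimately periodic orbit of $\tau_{\mathbf{r}}$ ends up in the trivial cycle $(0)$, i.e. satisfies $a_n=0$ for all sufficiently large $n$.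 -}

module Defs where

open import Data.Fin using (Fin; toℕ)
open import Data.Integer as ℤ using (ℤ; 0ℤ)
open import Data.Nat as ℕ using (ℕ; suc)
open import Data.Nat.DivMod using (_mod_)
import Data.Nat.Properties as ℕ
open import Data.Product using (_×_; _,_; ∃-syntax)
open import Data.Rational as ℚ using (ℚ; 0ℚ; 1ℚ; ½; Positive)
import Data.Rational.Properties as ℚ
open import Data.Rational.Solver using (module +-*-Solver)
open import Data.Sum using (inj₁; inj₂)
open import Data.Vec using (Vec; lookup)
open import Level using (0ℓ)
open import Relation.Binary.PropositionalEquality
  using (_≡_; refl; sym; trans; cong; cong₂; subst)
open import Relation.Unary using (Pred)

------------------------------------------------------------------------
-- Real numbers, as Cauchy sequences of rationals.
-- Equality of reals is the setoid equality _≈_, not _≡_.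

Eventually : (ℕ → Set) → Set
Eventually P = ∃[ N ] ∀ n → N ℕ.≤ n → P n

IsCauchy : (ℕ → ℚ) → Set
IsCauchy s = ∀ ε → 0ℚ ℚ.< ε →
  ∃[ N ] ∀ m n → N ℕ.≤ m → N ℕ.≤ n → ℚ.∣ s m ℚ.- s n ∣ ℚ.< ε

record ℝ : Set where
  constructor mkℝ
  field
    seq    : ℕ → ℚ
    cauchy : IsCauchy seq

open ℝ public

infix 4 _≈_ _≤_ _<_

_≈_ : ℝ → ℝ → Set
x ≈ y = ∀ ε → 0ℚ ℚ.< ε → Eventually λ n → ℚ.∣ seq x n ℚ.- seq y n ∣ ℚ.< ε

_≤_ : ℝ → ℝ → Set
x ≤ y = ∀ ε → 0ℚ ℚ.< ε → Eventually λ n → seq x n ℚ.< seq y n ℚ.+ ε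

_<_ : ℝ → ℝ → Set
x < y = ∃[ ε ] 0ℚ ℚ.< ε × Eventually λ n → seq x n ℚ.+ ε ℚ.< seq y n

private
  halve : ∀ ε → ½ ℚ.* ε ℚ.+ ½ ℚ.* ε ≡ ε
  halve ε = trans (sym (ℚ.*-distribʳ-+ ε ½ ½)) (ℚ.*-identityˡ ε)

  pos-* : ∀ p q → .{{Positive p}} → 0ℚ ℚ.< q → 0ℚ ℚ.< p ℚ.* q
  pos-* p q 0<q = subst (ℚ._< p ℚ.* q) (ℚ.*-zeroʳ p) (ℚ.*-monoʳ-<-pos p 0<q)

  ∣p-p∣≡0 : ∀ p → ℚ.∣ p ℚ.- p ∣ ≡ 0ℚ
  ∣p-p∣≡0 p = cong ℚ.∣_∣ (ℚ.+-inverseʳ p)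

  ∣-∣-swap : ∀ p q → ℚ.∣ p ℚ.- q ∣ ≡ ℚ.∣ q ℚ.- p ∣
  ∣-∣-swap p q = trans (sym (ℚ.∣-p∣≡∣p∣ (p ℚ.- q))) (cong ℚ.∣_∣
    (+-*-Solver.solve 2 (λ a b → :- (a :- b) := b :- a) refl p q))
    where open +-*-Solver

  ∣p∣≤∣q∣+∣p-q∣ : ∀ p q → ℚ.∣ p ∣ ℚ.≤ ℚ.∣ q ∣ ℚ.+ ℚ.∣ p ℚ.- q ∣
  ∣p∣≤∣q∣+∣p-q∣ p q = begin
    ℚ.∣ p ∣                        ≡⟨ cong ℚ.∣_∣ (solve 2 (λ a b → a := b :+ (a :- b)) refl p q) ⟩
    ℚ.∣ q ℚ.+ (p ℚ.- q) ∣          ≤⟨ ℚ.∣p+q∣≤∣p∣+∣q∣ q (p ℚ.- q) ⟩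
    ℚ.∣ q ∣ ℚ.+ ℚ.∣ p ℚ.- q ∣      ∎
    where
    open ℚ.≤-Reasoning
    open +-*-Solver using (solve; _:+_; _:-_; _:=_)

  ∣p∣-∣q∣≤∣p-q∣ : ∀ p q → ℚ.∣ p ∣ ℚ.- ℚ.∣ q ∣ ℚ.≤ ℚ.∣ p ℚ.- q ∣
  ∣p∣-∣q∣≤∣p-q∣ p q = begin
    ℚ.∣ p ∣ ℚ.- ℚ.∣ q ∣                         ≤⟨ ℚ.+-monoˡ-≤ (ℚ.- ℚ.∣ q ∣) (∣p∣≤∣q∣+∣p-q∣ p q) ⟩
    ℚ.∣ q ∣ ℚ.+ ℚ.∣ p ℚ.- q ∣ ℚ.- ℚ.∣ q ∣       ≡⟨ solve 2 (λ a b → a :+ b :- a := b) refl ℚ.∣ q ∣ ℚ.∣ p ℚ.- q ∣ ⟩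
    ℚ.∣ p ℚ.- q ∣                               ∎
    where
    open ℚ.≤-Reasoning
    open +-*-Solver using (solve; _:+_; _:-_; _:=_)

  ∣∣p∣-∣q∣∣≤∣p-q∣ : ∀ p q → ℚ.∣ ℚ.∣ p ∣ ℚ.- ℚ.∣ q ∣ ∣ ℚ.≤ ℚ.∣ p ℚ.- q ∣
  ∣∣p∣-∣q∣∣≤∣p-q∣ p q with ℚ.∣p∣≡p∨∣p∣≡-p (ℚ.∣ p ∣ ℚ.- ℚ.∣ q ∣)
  ... | inj₁ eq = subst (ℚ._≤ ℚ.∣ p ℚ.- q ∣) (sym eq) (∣p∣-∣q∣≤∣p-q∣ p q)
  ... | inj₂ eq = begin
    ℚ.∣ ℚ.∣ p ∣ ℚ.- ℚ.∣ q ∣ ∣      ≡⟨ eq ⟩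
    ℚ.- (ℚ.∣ p ∣ ℚ.- ℚ.∣ q ∣)      ≡⟨ solve 2 (λ a b → :- (a :- b) := b :- a) refl ℚ.∣ p ∣ ℚ.∣ q ∣ ⟩
    ℚ.∣ q ∣ ℚ.- ℚ.∣ p ∣            ≤⟨ ∣p∣-∣q∣≤∣p-q∣ q p ⟩
    ℚ.∣ q ℚ.- p ∣                  ≡⟨ ∣-∣-swap q p ⟩
    ℚ.∣ p ℚ.- q ∣                  ∎
    where
    open ℚ.≤-Reasoning
    open +-*-Solver using (solve; :-_; _:-_; _:=_)

  +-cauchy : ∀ {s t} → IsCauchy s → IsCauchy t → IsCauchy (λ n → s n ℚ.+ t n)
  +-cauchy {s} {t} cs ct ε 0<ε
    with cs (½ ℚ.* ε) (pos-* ½ ε 0<ε) | ct (½ ℚ.* ε) (pos-* ½ ε 0<ε)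
  ... | M , p | N , q = M ℕ.⊔ N , λ m n m≥ n≥ → begin-strict
    ℚ.∣ (s m ℚ.+ t m) ℚ.- (s n ℚ.+ t n) ∣
      ≡⟨ cong ℚ.∣_∣ (solve 4 (λ a b c d → (a :+ b) :- (c :+ d) := (a :- c) :+ (b :- d)) refl (s m) (t m) (s n) (t n)) ⟩
    ℚ.∣ (s m ℚ.- s n) ℚ.+ (t m ℚ.- t n) ∣
      ≤⟨ ℚ.∣p+q∣≤∣p∣+∣q∣ (s m ℚ.- s n) (t m ℚ.- t n) ⟩
    ℚ.∣ s m ℚ.- s n ∣ ℚ.+ ℚ.∣ t m ℚ.- t n ∣
      <⟨ ℚ.+-mono-< (p m n (ℕ.m⊔n≤o⇒m≤o M N m≥) (ℕ.m⊔n≤o⇒m≤o M N n≥))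
                    (q m n (ℕ.m⊔n≤o⇒n≤o M N m≥) (ℕ.m⊔n≤o⇒n≤o M N n≥)) ⟩
    ½ ℚ.* ε ℚ.+ ½ ℚ.* ε
      ≡⟨ halve ε ⟩
    ε ∎
    where
    open ℚ.≤-Reasoning
    open +-*-Solver using (solve; _:+_; _:-_; _:=_)

  neg-cauchy : ∀ {s} → IsCauchy s → IsCauchy (λ n → ℚ.- s n)
  neg-cauchy {s} cs ε 0<ε with cs ε 0<ε
  ... | N , p = N , λ m n m≥ n≥ → subst (ℚ._< ε) (eq (s m) (s n)) (p m n m≥ n≥)
    where
    open +-*-Solver using (solve; :-_; _:-_; _:=_)
    eq : ∀ a b → ℚ.∣ a ℚ.- b ∣ ≡ ℚ.∣ ℚ.- a ℚ.- ℚ.- b ∣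
    eq a b = trans (∣-∣-swap a b)
      (cong ℚ.∣_∣ (solve 2 (λ a b → b :- a := :- a :- :- b) refl a b))

  abs-cauchy : ∀ {s} → IsCauchy s → IsCauchy (λ n → ℚ.∣ s n ∣)
  abs-cauchy {s} cs ε 0<ε with cs ε 0<ε
  ... | N , p = N , λ m n m≥ n≥ →
    ℚ.≤-<-trans (∣∣p∣-∣q∣∣≤∣p-q∣ (s m) (s n)) (p m n m≥ n≥)

  bounded : ∀ {s} → IsCauchy s →
    ∃[ B ] Positive B × Eventually λ n → ℚ.∣ s n ∣ ℚ.≤ B
  bounded {s} cs with cs 1ℚ (ℚ.positive⁻¹ 1ℚ)
  ... | N , p = ℚ.∣ s N ∣ ℚ.+ 1ℚ
      , ℚ.nonNeg+pos⇒pos ℚ.∣ s N ∣ {{ℚ.∣-∣-nonNeg (s N)}} 1ℚ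
      , N , λ n n≥ → ℚ.≤-trans (∣p∣≤∣q∣+∣p-q∣ (s n) (s N))
          (ℚ.+-monoʳ-≤ ℚ.∣ s N ∣ (ℚ.<⇒≤ (p n N n≥ ℕ.≤-refl)))

  -- the required closeness ε / 2B of one factor when the other is at most B
  shrink : (B : ℚ) → Positive B → ∀ ε → 0ℚ ℚ.< ε →
    ∃[ δ ] 0ℚ ℚ.< δ × B ℚ.* δ ≡ ½ ℚ.* ε
  shrink B B>0 ε 0<ε = 1/B ℚ.* (½ ℚ.* ε) , pos-* 1/B (½ ℚ.* ε) {{ℚ.1/pos⇒pos B}} (pos-* ½ ε 0<ε) ,
    trans (sym (ℚ.*-assoc B 1/B (½ ℚ.* ε)))
      (trans (cong (ℚ._* (½ ℚ.* ε)) (ℚ.*-inverseʳ B)) (ℚ.*-identityˡ _))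
    where
    instance
      _ = B>0
      _ = ℚ.pos⇒nonZero B
    1/B = ℚ.1/ B

  ∣*∣-< : ∀ {B δ} p q → Positive B →
    ℚ.∣ p ∣ ℚ.≤ B → ℚ.∣ q ∣ ℚ.< δ → ℚ.∣ p ℚ.* q ∣ ℚ.< B ℚ.* δ
  ∣*∣-< {B} {δ} p q B>0 p≤B q<δ = begin-strict
    ℚ.∣ p ℚ.* q ∣            ≡⟨ ℚ.∣p*q∣≡∣p∣*∣q∣ p q ⟩
    ℚ.∣ p ∣ ℚ.* ℚ.∣ q ∣      ≤⟨ ℚ.*-monoʳ-≤-nonNeg ℚ.∣ q ∣ {{ℚ.∣-∣-nonNeg q}} p≤B ⟩
    B ℚ.* ℚ.∣ q ∣            <⟨ ℚ.*-monoʳ-<-pos B {{B>0}} q<δ ⟩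
    B ℚ.* δ                  ∎
    where open ℚ.≤-Reasoning

  *-difference : ∀ a b c d →
    a ℚ.* b ℚ.- c ℚ.* d ≡ a ℚ.* (b ℚ.- d) ℚ.+ d ℚ.* (a ℚ.- c)
  *-difference = solve 4 (λ a b c d →
    a :* b :- c :* d := a :* (b :- d) :+ d :* (a :- c)) refl
    where open +-*-Solver using (solve; _:+_; _:*_; _:-_; _:=_)

  *-close : ∀ {B C δ η} a b c d → Positive B → Positive C →
    ℚ.∣ a ∣ ℚ.≤ B → ℚ.∣ d ∣ ℚ.≤ C → ℚ.∣ b ℚ.- d ∣ ℚ.< δ → ℚ.∣ a ℚ.- c ∣ ℚ.< η →
    ℚ.∣ a ℚ.* b ℚ.- c ℚ.* d ∣ ℚ.< B ℚ.* δ ℚ.+ C ℚ.* η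
  *-close {B} {C} {δ} {η} a b c d B>0 C>0 a≤B d≤C b-d<δ a-c<η = begin-strict
    ℚ.∣ a ℚ.* b ℚ.- c ℚ.* d ∣
      ≡⟨ cong ℚ.∣_∣ (*-difference a b c d) ⟩
    ℚ.∣ a ℚ.* (b ℚ.- d) ℚ.+ d ℚ.* (a ℚ.- c) ∣
      ≤⟨ ℚ.∣p+q∣≤∣p∣+∣q∣ (a ℚ.* (b ℚ.- d)) (d ℚ.* (a ℚ.- c)) ⟩
    ℚ.∣ a ℚ.* (b ℚ.- d) ∣ ℚ.+ ℚ.∣ d ℚ.* (a ℚ.- c) ∣
      <⟨ ℚ.+-mono-< (∣*∣-< a (b ℚ.- d) B>0 a≤B b-d<δ) (∣*∣-< d (a ℚ.- c) C>0 d≤C a-c<η) ⟩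
    B ℚ.* δ ℚ.+ C ℚ.* η ∎
    where open ℚ.≤-Reasoning

  *-cauchy : ∀ {s t} → IsCauchy s → IsCauchy t → IsCauchy (λ n → s n ℚ.* t n)
  *-cauchy {s} {t} cs ct ε 0<ε =
    let (B , B>0 , K , s≤B) = bounded cs
        (C , C>0 , L , t≤C) = bounded ct
        (δ , 0<δ , Bδ≡½ε)   = shrink B B>0 ε 0<ε
        (η , 0<η , Cη≡½ε)   = shrink C C>0 ε 0<ε
        (M , t-close)       = ct δ 0<δ
        (N , s-close)       = cs η 0<η
        ≥KL : ∀ {n} → (K ℕ.⊔ L) ℕ.⊔ (M ℕ.⊔ N) ℕ.≤ n → K ℕ.⊔ L ℕ.≤ n
        ≥KL = ℕ.m⊔n≤o⇒m≤o (K ℕ.⊔ L) (M ℕ.⊔ N)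
        ≥MN : ∀ {n} → (K ℕ.⊔ L) ℕ.⊔ (M ℕ.⊔ N) ℕ.≤ n → M ℕ.⊔ N ℕ.≤ n
        ≥MN = ℕ.m⊔n≤o⇒n≤o (K ℕ.⊔ L) (M ℕ.⊔ N)
    in (K ℕ.⊔ L) ℕ.⊔ (M ℕ.⊔ N) , λ m n m≥ n≥ →
      subst (ℚ.∣ s m ℚ.* t m ℚ.- s n ℚ.* t n ∣ ℚ.<_)
        (trans (cong₂ ℚ._+_ Bδ≡½ε Cη≡½ε) (halve ε))
        (*-close (s m) (t m) (s n) (t n) B>0 C>0
          (s≤B m (ℕ.m⊔n≤o⇒m≤o K L (≥KL m≥)))
          (t≤C n (ℕ.m⊔n≤o⇒n≤o K L (≥KL n≥)))
          (t-close m n (ℕ.m⊔n≤o⇒m≤o M N (≥MN m≥)) (ℕ.m⊔n≤o⇒m≤o M N (≥MN n≥)))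
          (s-close m n (ℕ.m⊔n≤o⇒n≤o M N (≥MN m≥)) (ℕ.m⊔n≤o⇒n≤o M N (≥MN n≥))))

infixl 6 _+_ _-_
infixl 7 _*_
infix  8 -_

_+_ _*_ : ℝ → ℝ → ℝ
x + y = mkℝ (λ n → seq x n ℚ.+ seq y n) (+-cauchy {seq x} {seq y} (cauchy x) (cauchy y))
x * y = mkℝ (λ n → seq x n ℚ.* seq y n) (*-cauchy {seq x} {seq y} (cauchy x) (cauchy y))

-_ ∣_∣ : ℝ → ℝ
- x   = mkℝ (λ n → ℚ.- seq x n) (neg-cauchy {seq x} (cauchy x))
∣ x ∣ = mkℝ (λ n → ℚ.∣ seq x n ∣) (abs-cauchy {seq x} (cauchy x))

_-_ : ℝ → ℝ → ℝ
x - y = x + (- y)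

fromℚ : ℚ → ℝ
fromℚ q = mkℝ (λ _ → q) λ ε 0<ε → 0 , λ _ _ _ _ → subst (ℚ._< ε) (sym (∣p-p∣≡0 q)) 0<ε

fromℤ : ℤ → ℝ
fromℤ k = fromℚ (k ℚ./ 1)

0ℝ 1ℝ ½ℝ : ℝ
0ℝ = fromℚ 0ℚ
1ℝ = fromℚ 1ℚ
½ℝ = fromℚ ½

------------------------------------------------------------------------
-- Shift radix systems

-- The floor is not computable on ℝ, so it and the map τ are given by
-- their graphs.
IsFloor : ℝ → ℤ → Set
IsFloor x k = fromℤ k ≤ x × x < fromℤ k + 1ℝ

τ[_]_↦_ : ℝ × ℝ → ℤ × ℤ → ℤ × ℤ → Set
τ[ r₀ , r₁ ] (a₀ , a₁) ↦ (b₀ , b₁) =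
  b₀ ≡ a₁ ×
  ∃[ k ] IsFloor (r₀ * fromℤ a₀ + r₁ * fromℤ a₁) k × b₁ ≡ ℤ.- k

IsOrbit : ℝ × ℝ → (ℕ → ℤ) → Set
IsOrbit r a = ∀ n → τ[ r ] (a n , a (1 ℕ.+ n)) ↦ (a (1 ℕ.+ n) , a (2 ℕ.+ n))

PeriodicFrom : (ℕ → ℤ) → (n₀ p : ℕ) → Set
PeriodicFrom a n₀ p = 0 ℕ.< p × (∀ n → n₀ ℕ.≤ n → a (n ℕ.+ p) ≡ a n)

UltimatelyPeriodic : (ℕ → ℤ) → Set
UltimatelyPeriodic a = ∃[ n₀ ] ∃[ p ] PeriodicFrom a n₀ p

IsCycle : ∀ {p} → ℝ × ℝ → Vec ℤ p → Set
IsCycle {p} r c = ∃[ a ] IsOrbit r a × ∃[ n₀ ] PeriodicFrom a n₀ p ×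
  ∃[ n ] n₀ ℕ.≤ n × (∀ i → lookup c i ≡ a (n ℕ.+ toℕ i))

cyclicSuc : ∀ {p} → Fin p → Fin p
cyclicSuc {suc m} i = suc (toℕ i) mod suc m

AlternatingSigns : ∀ {p} → Vec ℤ p → Set
AlternatingSigns c = ∀ i → lookup c i ℤ.* lookup c (cyclicSuc i) ℤ.< 0ℤ

D₂⁽*⁾ : Pred (ℝ × ℝ) 0ℓ
D₂⁽*⁾ r = ∀ a → IsOrbit r a → UltimatelyPeriodic a → Eventually λ n → a n ≡ 0ℤ

-- {(r₀ , r₀ + 1) ∣ r₀ ∈ ℝ}, closed under equality of reals
Line : Pred (ℝ × ℝ) 0ℓ
Line (x , y) = ∃[ r₀ ] x ≈ r₀ × y ≈ r₀ + 1ℝ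

{-# OPTIONS --safe #-}

-- The quantity r₀ aₙ + r₁ aₙ₊₁ + aₙ₊₂ is the fractional part of r₀ aₙ + r₁ aₙ₊₁, so it
-- lies in [0, 1).  Let a be a periodic orbit with alternating signs and period p,
-- shifted so that a₀ > 0, and let u_j = a_{2j} − a_{2j+1} ≥ 2.  The differences of the
-- fractional parts at 2j and 2j + 1 have absolute value less than 1 ≤ u_j / 2, and over
-- j < p they sum to (r₀ − r₁ + 1) Σ u_j; divide by Σ u_j.  For a cycle (t, −t) the fractional parts are
-- ± t (r₀ − r₁ + 1); both being nonnegative, they vanish.

module Submission where

open import Defs
open import Data.Fin using (Fin; toℕ; zero; suc)
open import Data.Fin.Properties using (toℕ-fromℕ<)
open import Data.Integer as ℤ using (ℤ; 0ℤ; 1ℤ; -1ℤ; +_; -[1+_])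
import Data.Integer.Properties as ℤ
open import Data.Nat as ℕ using (ℕ; zero; suc)
open import Data.Nat.DivMod using (_mod_; _%_; _/_; m≡m%n+[m/n]*n; m%n<n)
import Data.Nat.Properties as ℕ
open import Data.Product using (_×_; _,_; proj₁; proj₂; ∃-syntax)
open import Data.Rational as ℚ using (ℚ; 0ℚ; 1ℚ; ½)
import Data.Rational.Properties as ℚ
open import Data.Rational.Solver using (module +-*-Solver)
import Data.Rational.Unnormalised as ℚᵘ
import Data.Rational.Unnormalised.Properties as ℚᵘ
open import Data.Sum using (inj₁; inj₂)
open import Data.Vec using (Vec; []; _∷_; lookup)
open import Function.Bundles using (_⇔_; mk⇔)
open import Relation.Binary.Definitions using (tri<; tri≈; tri>)
open import Relation.Binary.PropositionalEquality
  using (_≡_; _≢_; refl; sym; trans; cong; cong₂; subst; subst₂; module ≡-Reasoning)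
open import Relation.Nullary using (contradiction)
open import Relation.Unary using (Empty; _∩_)

open +-*-Solver using (solve; con; :-_; _:+_; _:*_; _:-_; _:=_)

-- Eventual properties and rational inequalities

Eventually-∧ : ∀ {P Q : ℕ → Set} → Eventually P → Eventually Q → Eventually λ n → P n × Q n
Eventually-∧ (M , p) (N , q) = M ℕ.⊔ N , λ n n≥ →
  p n (ℕ.m⊔n≤o⇒m≤o M N n≥) , q n (ℕ.m⊔n≤o⇒n≤o M N n≥)

Eventually-map : ∀ {P Q : ℕ → Set} → (∀ n → P n → Q n) → Eventually P → Eventually Q
Eventually-map f (N , p) = N , λ n n≥ → f n (p n n≥)

½*-positive : ∀ {p} → 0ℚ ℚ.< p → 0ℚ ℚ.< ½ ℚ.* p
½*-positive = ℚ.*-monoʳ-<-pos ½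

+-cancelʳ-<ℚ : ∀ r {p q} → p ℚ.+ r ℚ.< q ℚ.+ r → p ℚ.< q
+-cancelʳ-<ℚ r {p} {q} lt = subst₂ ℚ._<_ (cancel p r) (cancel q r) (ℚ.+-monoˡ-< (ℚ.- r) lt)
  where
  cancel : ∀ a b → a ℚ.+ b ℚ.- b ≡ a
  cancel = solve 2 (λ a b → a :+ b :- b := a) refl

∣∣-<ℚ : ∀ {p q} → p ℚ.< q → ℚ.- p ℚ.< q → ℚ.∣ p ∣ ℚ.< q
∣∣-<ℚ {p} {q} p<q -p<q with ℚ.∣p∣≡p∨∣p∣≡-p p
... | inj₁ eq = subst (ℚ._< q) (sym eq) p<q
... | inj₂ eq = subst (ℚ._< q) (sym eq) -p<q

p≤∣p∣ : ∀ p → p ℚ.≤ ℚ.∣ p ∣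
p≤∣p∣ p with ℚ.≤-total 0ℚ p
... | inj₁ 0≤p = ℚ.≤-reflexive (sym (ℚ.0≤p⇒∣p∣≡p 0≤p))
... | inj₂ p≤0 = ℚ.≤-trans p≤0 (ℚ.nonNegative⁻¹ _ {{ℚ.∣-∣-nonNeg p}})

-p≤∣p∣ : ∀ p → ℚ.- p ℚ.≤ ℚ.∣ p ∣
-p≤∣p∣ p = subst (ℚ.- p ℚ.≤_) (ℚ.∣-p∣≡∣p∣ p) (p≤∣p∣ (ℚ.- p))

-- Embedding of ℤ into ℚ

ι : ℤ → ℚ
ι k = k ℚ./ 1

ι-neg : ∀ k → ι (ℤ.- k) ≡ ℚ.- ι k
ι-neg (+ zero)   = refl
ι-neg (+ suc n)  = refl
-- `-[1+ n ] / 1` unfolds to the negation of `+ suc n / 1`, which leaves a double negation.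
ι-neg -[1+ n ]   = solve 1 (λ a → a := :- (:- a)) refl (ι (+ suc n))

ι-pos : ∀ {k} → 0ℤ ℤ.< k → 1ℚ ℚ.≤ ι k
-- Comparing unnormalised fractions bypasses the gcd in `k / 1`; cross-multiplication leaves an
-- inequality of integers.
ι-pos {+ suc n} _ = ℚ.toℚᵘ-cancel-≤ (ℚᵘ.≤-respʳ-≃
  (ℚᵘ.≃-sym (ℚ.toℚᵘ-fromℚᵘ (ℚᵘ.mkℚᵘ (+ suc n) 0)))
  (ℚᵘ.*≤* (ℤ.*-monoʳ-≤-nonNeg 1ℤ (ℤ.+≤+ {1} {suc n} (ℕ.s≤s ℕ.z≤n)))))
ι-pos {+ zero} (ℤ.+<+ ())

ι-neg⇒≤-1 : ∀ {k} → k ℤ.< 0ℤ → ι k ℚ.≤ ℚ.- 1ℚ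
ι-neg⇒≤-1 { -[1+ n ]} _ = ℚ.neg-antimono-≤ (ι-pos {+ suc n} (ℤ.+<+ (ℕ.s≤s ℕ.z≤n)))
ι-neg⇒≤-1 {+ n} (ℤ.+<+ ())

1≤∣ι∣ : ∀ {k} → k ≢ 0ℤ → 1ℚ ℚ.≤ ℚ.∣ ι k ∣
1≤∣ι∣ {k} k≢0 with ℤ.<-cmp k 0ℤ
... | tri< k<0 _ _ = ℚ.≤-trans (ℚ.neg-antimono-≤ (ι-neg⇒≤-1 k<0)) (-p≤∣p∣ (ι k))
... | tri≈ _ k≡0 _ = contradiction k≡0 k≢0
... | tri> _ _ 0<k = ℚ.≤-trans (ι-pos 0<k) (p≤∣p∣ (ι k))

-- Strict inequalities between reals

-- Pointwise equality is enough for the rewriting below: the identities used are ring identities,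
-- which hold at every index of the approximating sequences.
<-respˡ-≗ : ∀ x y z → (∀ i → seq x i ≡ seq y i) → x < z → y < z
<-respˡ-≗ x y z eq (ε , 0<ε , ev) = ε , 0<ε ,
  Eventually-map (λ i → subst (λ a → a ℚ.+ ε ℚ.< seq z i) (eq i)) ev

<-≤-transℚ : ∀ x {p q} → x < fromℚ p → p ℚ.≤ q → x < fromℚ q
<-≤-transℚ x (ε , 0<ε , ev) p≤q = ε , 0<ε , Eventually-map (λ _ lt → ℚ.<-≤-trans lt p≤q) ev

∣x-y∣<1 : ∀ x y → 0ℝ ≤ x → x < 1ℝ → 0ℝ ≤ y → y < 1ℝ → ∣ x - y ∣ < 1ℝ
∣x-y∣<1 x y 0≤x (ε , 0<ε , x<1) 0≤y (η , 0<η , y<1) = δ , 0<δ ,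
  Eventually-map (λ i ((p , q) , (r , s)) →
    p<1-δ⇒p+δ<1 ℚ.∣ seq x i ℚ.- seq y i ∣ (∣∣-<ℚ
      (bound (seq x i) (seq y i) 2δ≤ε p s)
      (subst (ℚ._< 1ℚ ℚ.- δ) (swap (seq x i) (seq y i)) (bound (seq y i) (seq x i) 2δ≤η r q))))
    (Eventually-∧ (Eventually-∧ x<1 (0≤x δ 0<δ)) (Eventually-∧ y<1 (0≤y δ 0<δ)))
  where
  -- Both upper bounds hold with margin at least `δ + δ`. One `δ` pays for the lower bounds, which
  -- hold only up to an error; the other is the margin of the result.
  δ = ½ ℚ.* (ε ℚ.⊓ η)

  0<δ : 0ℚ ℚ.< δ
  0<δ with ℚ.⊓-sel ε η
  ... | inj₁ eq = ½*-positive (subst (0ℚ ℚ.<_) (sym eq) 0<ε)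
  ... | inj₂ eq = ½*-positive (subst (0ℚ ℚ.<_) (sym eq) 0<η)

  2δ : δ ℚ.+ δ ≡ ε ℚ.⊓ η
  2δ = solve 1 (λ a → con ½ :* a :+ con ½ :* a := a) refl (ε ℚ.⊓ η)

  2δ≤ε : δ ℚ.+ δ ℚ.≤ ε
  2δ≤ε = subst (ℚ._≤ ε) (sym 2δ) (ℚ.p⊓q≤p ε η)

  2δ≤η : δ ℚ.+ δ ℚ.≤ η
  2δ≤η = subst (ℚ._≤ η) (sym 2δ) (ℚ.p⊓q≤q ε η)

  swap : ∀ a b → b ℚ.- a ≡ ℚ.- (a ℚ.- b)
  swap = solve 2 (λ a b → b :- a := :- (a :- b)) refl

  p<1-δ⇒p+δ<1 : ∀ p → p ℚ.< 1ℚ ℚ.- δ → p ℚ.+ δ ℚ.< 1ℚ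
  p<1-δ⇒p+δ<1 p lt = subst (p ℚ.+ δ ℚ.<_) (solve 1 (λ a → con 1ℚ :- a :+ a := con 1ℚ) refl δ)
    (ℚ.+-monoˡ-< δ lt)

  bound : ∀ a b {ζ} → δ ℚ.+ δ ℚ.≤ ζ → a ℚ.+ ζ ℚ.< 1ℚ → 0ℚ ℚ.< b ℚ.+ δ → a ℚ.- b ℚ.< 1ℚ ℚ.- δ
  bound a b {ζ} 2δ≤ζ a+ζ<1 0<b+δ = +-cancelʳ-<ℚ (b ℚ.+ δ ℚ.+ δ) (begin-strict
    a ℚ.- b ℚ.+ (b ℚ.+ δ ℚ.+ δ)
      ≡⟨ solve 3 (λ a b d → a :- b :+ (b :+ d :+ d) := a :+ (d :+ d)) refl a b δ ⟩
    a ℚ.+ (δ ℚ.+ δ)             ≤⟨ ℚ.+-monoʳ-≤ a 2δ≤ζ ⟩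
    a ℚ.+ ζ                     <⟨ a+ζ<1 ⟩
    1ℚ                          <⟨ ℚ.+-monoʳ-< 1ℚ 0<b+δ ⟩
    1ℚ ℚ.+ (b ℚ.+ δ)
      ≡⟨ solve 2 (λ b d → con 1ℚ :+ (b :+ d) := con 1ℚ :- d :+ (b :+ d :+ d)) refl b δ ⟩
    1ℚ ℚ.- δ ℚ.+ (b ℚ.+ δ ℚ.+ δ) ∎)
    where open ℚ.≤-Reasoning

∣x+y∣<z+w : ∀ x y z w → ∣ x ∣ < z → ∣ y ∣ < w → ∣ x + y ∣ < z + w
∣x+y∣<z+w x y z w (ε , 0<ε , x<z) (η , 0<η , y<w) = ε ℚ.+ η , ℚ.+-mono-< 0<ε 0<η ,
  Eventually-map (λ i (p , q) → begin-strict
    ℚ.∣ seq x i ℚ.+ seq y i ∣ ℚ.+ (ε ℚ.+ η)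
      ≤⟨ ℚ.+-monoˡ-≤ (ε ℚ.+ η) (ℚ.∣p+q∣≤∣p∣+∣q∣ (seq x i) (seq y i)) ⟩
    ℚ.∣ seq x i ∣ ℚ.+ ℚ.∣ seq y i ∣ ℚ.+ (ε ℚ.+ η)
      ≡⟨ solve 4 (λ a b c d → a :+ b :+ (c :+ d) := a :+ c :+ (b :+ d)) refl
           ℚ.∣ seq x i ∣ ℚ.∣ seq y i ∣ ε η ⟩
    ℚ.∣ seq x i ∣ ℚ.+ ε ℚ.+ (ℚ.∣ seq y i ∣ ℚ.+ η)
      <⟨ ℚ.+-mono-< p q ⟩
    seq z i ℚ.+ seq w i ∎)
    (Eventually-∧ x<z y<w)
  where open ℚ.≤-Reasoning

-- Division by `q` scales the margin along with both sides, from `ε` to `ε * 1/q`.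
∣x∣-cancelʳ-< : ∀ x p q → 0ℚ ℚ.< q → ∣ x * fromℚ q ∣ < fromℚ (p ℚ.* q) → ∣ x ∣ < fromℚ p
∣x∣-cancelʳ-< x p q 0<q (ε , 0<ε , ev) = ε ℚ.* 1/q , 0<ε/q ,
  Eventually-map (λ i lt → ℚ.*-cancelʳ-<-nonNeg q (subst (ℚ._< p ℚ.* q) (eq i) lt)) ev
  where
  instance
    q-pos = ℚ.positive 0<q
    q-nonNeg = ℚ.pos⇒nonNeg q
    q-nonZero = ℚ.pos⇒nonZero q
  1/q = ℚ.1/ q

  0<ε/q : 0ℚ ℚ.< ε ℚ.* 1/q
  0<ε/q = ℚ.positive⁻¹ _ {{ℚ.pos*pos⇒pos ε {{ℚ.positive 0<ε}} 1/q {{ℚ.1/pos⇒pos q}}}}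

  open ≡-Reasoning
  eq : ∀ i → ℚ.∣ seq x i ℚ.* q ∣ ℚ.+ ε ≡ (ℚ.∣ seq x i ∣ ℚ.+ ε ℚ.* 1/q) ℚ.* q
  eq i = begin
    ℚ.∣ seq x i ℚ.* q ∣ ℚ.+ ε
      ≡⟨ cong₂ ℚ._+_ (ℚ.∣p*q∣≡∣p∣*∣q∣ (seq x i) q) (sym (ℚ.*-identityʳ ε)) ⟩
    ℚ.∣ seq x i ∣ ℚ.* ℚ.∣ q ∣ ℚ.+ ε ℚ.* 1ℚ
      ≡⟨ cong₂ (λ a b → ℚ.∣ seq x i ∣ ℚ.* a ℚ.+ ε ℚ.* b)
           (ℚ.0≤p⇒∣p∣≡p (ℚ.<⇒≤ 0<q)) (sym (ℚ.*-inverseˡ q)) ⟩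
    ℚ.∣ seq x i ∣ ℚ.* q ℚ.+ ε ℚ.* (1/q ℚ.* q)
      ≡⟨ solve 4 (λ a b c d → a :* b :+ c :* (d :* b) := (a :+ c :* d) :* b) refl
           ℚ.∣ seq x i ∣ q ε 1/q ⟩
    (ℚ.∣ seq x i ∣ ℚ.+ ε ℚ.* 1/q) ℚ.* q ∎

-- Orbits

-- The next term of an orbit stands in for minus the floor, so the floor, given only as a relation,
-- does not have to be computed.
fracPart : ℝ × ℝ → (ℕ → ℤ) → ℕ → ℝ
fracPart (r₀ , r₁) a n =
  r₀ * fromℤ (a n) + r₁ * fromℤ (a (1 ℕ.+ n)) + fromℤ (a (2 ℕ.+ n))

module _ (r : ℝ × ℝ) (a : ℕ → ℤ) (orbit : IsOrbit r a) where

  value : ℕ → ℕ → ℚ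
  value n i = seq (proj₁ r) i ℚ.* ι (a n) ℚ.+ seq (proj₂ r) i ℚ.* ι (a (1 ℕ.+ n))

  fracPart-nonNeg : ∀ n → 0ℝ ≤ fracPart r a n
  fracPart-nonNeg n ε 0<ε with orbit n
  ... | _ , k , (k≤x , _) , eq = Eventually-map (λ i lt → subst₂ ℚ._<_
      (trans (cong (ι k ℚ.+_) eq′) (ℚ.+-inverseʳ (ι k)))
      (solve 3 (λ a b c → a :+ c :+ b := a :+ b :+ c) refl (value n i) (ι (a (2 ℕ.+ n))) ε)
      (ℚ.+-monoˡ-< (ι (a (2 ℕ.+ n))) lt)) (k≤x ε 0<ε)
    where
    eq′ : ι (a (2 ℕ.+ n)) ≡ ℚ.- ι k
    eq′ = trans (cong ι eq) (ι-neg k)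

  fracPart<1 : ∀ n → fracPart r a n < 1ℝ
  fracPart<1 n with orbit n
  ... | _ , k , (_ , ε , 0<ε , x<k+1) , eq = ε , 0<ε , Eventually-map (λ i lt → subst₂ ℚ._<_
      (solve 3 (λ a b c → a :+ c :+ b := a :+ b :+ c) refl (value n i) (ι (a (2 ℕ.+ n))) ε)
      (trans (cong (ι k ℚ.+ 1ℚ ℚ.+_) eq′)
        (solve 1 (λ a → a :+ con 1ℚ :- a := con 1ℚ) refl (ι k)))
      (ℚ.+-monoˡ-< (ι (a (2 ℕ.+ n))) lt)) x<k+1
    where
    eq′ : ι (a (2 ℕ.+ n)) ≡ ℚ.- ι k
    eq′ = trans (cong ι eq) (ι-neg k)

-- Periodic and alternating integer sequences

Periodic : ℕ → (ℕ → ℤ) → Set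
Periodic p b = ∀ k → b (k ℕ.+ p) ≡ b k

periodic-* : ∀ {p b} → Periodic p b → ∀ q k → b (k ℕ.+ q ℕ.* p) ≡ b k
periodic-* {p} {b} per zero    k = cong b (ℕ.+-identityʳ k)
periodic-* {p} {b} per (suc q) k = begin
  b (k ℕ.+ (p ℕ.+ q ℕ.* p))    ≡⟨ cong (λ m → b (k ℕ.+ m)) (ℕ.+-comm p (q ℕ.* p)) ⟩
  b (k ℕ.+ (q ℕ.* p ℕ.+ p))    ≡⟨ cong b (ℕ.+-assoc k (q ℕ.* p) p) ⟨
  b (k ℕ.+ q ℕ.* p ℕ.+ p)      ≡⟨ per (k ℕ.+ q ℕ.* p) ⟩
  b (k ℕ.+ q ℕ.* p)            ≡⟨ periodic-* per q k ⟩
  b k                          ∎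
  where open ≡-Reasoning

periodic-% : ∀ {p b} .{{_ : ℕ.NonZero p}} → Periodic p b → ∀ m → b (m % p) ≡ b m
periodic-% {p} {b} per m =
  trans (sym (periodic-* per (m / p) (m % p))) (cong b (sym (m≡m%n+[m/n]*n m p)))

Alternating : (ℕ → ℤ) → Set
Alternating b = ∀ m → b m ℤ.* b (suc m) ℤ.< 0ℤ

-- Each `m` reduces modulo the period to a position in the cycle, and reduction commutes with the
-- successor, including the wrap from the last entry to the first.
alternatingSigns⇒alternating : ∀ {p b} (c : Vec ℤ (suc p)) → Periodic (suc p) b →
  (∀ i → lookup c i ≡ b (toℕ i)) → AlternatingSigns c → Alternating b
alternatingSigns⇒alternating {p} {b} c per c≡b alt m =
  subst (ℤ._< 0ℤ) (cong₂ ℤ._*_ c[i]≡b[m] c[i+1]≡b[m+1]) (alt i)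
  where
  open ≡-Reasoning
  i = m mod suc p

  toℕ-mod : ∀ m → toℕ (m mod suc p) ≡ m % suc p
  toℕ-mod m = toℕ-fromℕ< (m%n<n m (suc p))

  c[i]≡b[m] : lookup c i ≡ b m
  c[i]≡b[m] = begin
    lookup c i      ≡⟨ c≡b i ⟩
    b (toℕ i)       ≡⟨ cong b (toℕ-mod m) ⟩
    b (m % suc p)   ≡⟨ periodic-% per m ⟩
    b m             ∎

  c[i+1]≡b[m+1] : lookup c (cyclicSuc i) ≡ b (suc m)
  c[i+1]≡b[m+1] = begin
    lookup c (cyclicSuc i)      ≡⟨ c≡b (cyclicSuc i) ⟩
    b (toℕ (cyclicSuc i))       ≡⟨ cong b (toℕ-mod (suc (toℕ i))) ⟩
    b (suc (toℕ i) % suc p)     ≡⟨ periodic-% per (suc (toℕ i)) ⟩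
    b (suc (toℕ i))             ≡⟨ cong (λ k → b (suc k)) (toℕ-mod m) ⟩
    b (suc (m % suc p))         ≡⟨ periodic-% {b = λ k → b (suc k)} (λ k → per (suc k)) m ⟩
    b (suc m)                   ∎

i*j<0∧0<i⇒j<0 : ∀ {i j} → i ℤ.* j ℤ.< 0ℤ → 0ℤ ℤ.< i → j ℤ.< 0ℤ
i*j<0∧0<i⇒j<0 {i} {j} ij<0 0<i =
  ℤ.*-cancelˡ-<-nonNeg i {{ℤ.nonNegative (ℤ.<⇒≤ 0<i)}}
    (subst (i ℤ.* j ℤ.<_) (sym (ℤ.*-zeroʳ i)) ij<0)

i*j<0∧i<0⇒0<j : ∀ {i j} → i ℤ.* j ℤ.< 0ℤ → i ℤ.< 0ℤ → 0ℤ ℤ.< j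
i*j<0∧i<0⇒0<j {i} {j} ij<0 i<0 =
  ℤ.*-cancelˡ-<-nonPos i {{ℤ.nonPositive (ℤ.<⇒≤ i<0)}}
    (subst (i ℤ.* j ℤ.<_) (sym (ℤ.*-zeroʳ i)) ij<0)

-- Telescoping along an alternating orbit with positive first term

module PositiveStart (r₀ r₁ : ℝ) (b : ℕ → ℤ) (orbit : IsOrbit (r₀ , r₁) b)
  (alt : Alternating b) (0<b₀ : 0ℤ ℤ.< b 0) where

  even-pos : ∀ j → 0ℤ ℤ.< b (j ℕ.* 2)
  odd-neg  : ∀ j → b (1 ℕ.+ j ℕ.* 2) ℤ.< 0ℤ
  even-pos zero    = 0<b₀
  even-pos (suc j) = i*j<0∧i<0⇒0<j (alt (1 ℕ.+ j ℕ.* 2)) (odd-neg j)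
  odd-neg j        = i*j<0∧0<i⇒j<0 (alt (j ℕ.* 2)) (even-pos j)

  β : ℕ → ℚ
  β n = ι (b n)

  u : ℕ → ℚ
  u j = β (j ℕ.* 2) ℚ.- β (1 ℕ.+ j ℕ.* 2)

  -- Integrality enters here: a positive integer minus a negative one is at least 2. The bound 1 on
  -- the differences `d j` thus becomes proportional to `u j`, and can be summed.
  1≤½u : ∀ j → 1ℚ ℚ.≤ ½ ℚ.* u j
  1≤½u j = ℚ.*-monoˡ-≤-nonNeg ½
    (ℚ.+-mono-≤ (ι-pos (even-pos j)) (ℚ.neg-antimono-≤ (ι-neg⇒≤-1 (odd-neg j))))

  0<u : ∀ j → 0ℚ ℚ.< u j
  0<u j = ℚ.*-cancelˡ-<-nonNeg ½ (ℚ.<-≤-trans (ℚ.positive⁻¹ 1ℚ) (1≤½u j))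

  d : ℕ → ℝ
  d j = fracPart (r₀ , r₁) b (j ℕ.* 2) - fracPart (r₀ , r₁) b (1 ℕ.+ j ℕ.* 2)

  ∣d∣<½u : ∀ j → ∣ d j ∣ < fromℚ (½ ℚ.* u j)
  ∣d∣<½u j = <-≤-transℚ ∣ d j ∣ (∣x-y∣<1
    (fracPart (r₀ , r₁) b (j ℕ.* 2)) (fracPart (r₀ , r₁) b (1 ℕ.+ j ℕ.* 2))
    (fracPart-nonNeg (r₀ , r₁) b orbit (j ℕ.* 2)) (fracPart<1 (r₀ , r₁) b orbit (j ℕ.* 2))
    (fracPart-nonNeg (r₀ , r₁) b orbit (1 ℕ.+ j ℕ.* 2))
    (fracPart<1 (r₀ , r₁) b orbit (1 ℕ.+ j ℕ.* 2))) (1≤½u j)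

  -- The sum has `suc m` terms, as many as a period `suc m`. It is never empty, so it is positive
  -- and the strict bound on `T` already holds in the base case.
  U : ℕ → ℚ
  U zero    = u zero
  U (suc m) = U m ℚ.+ u (suc m)

  0<U : ∀ m → 0ℚ ℚ.< U m
  0<U zero    = 0<u zero
  0<U (suc m) = ℚ.+-mono-< (0<U m) (0<u (suc m))

  -- The telescoped form of d 0 + … + d m.
  T : ℕ → ℝ
  T m = r₀ * fromℚ (U m) + r₁ * fromℚ (β 0 ℚ.- U m ℚ.- β (suc m ℕ.* 2))
        + fromℚ (U m ℚ.+ u (suc m) ℚ.- u 0)

  d₀≗T₀ : ∀ i → seq (d 0) i ≡ seq (T 0) i
  d₀≗T₀ i = solve 6 (λ x y b₀ b₁ b₂ b₃ →
      x :* b₀ :+ y :* b₁ :+ b₂ :- (x :* b₁ :+ y :* b₂ :+ b₃) :=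
      x :* (b₀ :- b₁) :+ y :* (b₀ :- (b₀ :- b₁) :- b₂)
        :+ (b₀ :- b₁ :+ (b₂ :- b₃) :- (b₀ :- b₁)))
    refl (seq r₀ i) (seq r₁ i) (β 0) (β 1) (β 2) (β 3)

  -- The new difference adds `u (suc m)` to the coefficient of `r₀`, the odd-indexed term minus its
  -- successor to that of `r₁`, and `u (suc (suc m))` to the constant. Regrouping the `r₁` terms
  -- into pairs `u j` leaves only the two boundary terms of `b`.
  T+d≗T : ∀ m i → seq (T m + d (suc m)) i ≡ seq (T (suc m)) i
  T+d≗T m i = solve 9 (λ x y v b₀ u₀ b₂ b₃ b₄ b₅ →
      x :* v :+ y :* (b₀ :- v :- b₂) :+ (v :+ (b₂ :- b₃) :- u₀)
        :+ (x :* b₂ :+ y :* b₃ :+ b₄ :- (x :* b₃ :+ y :* b₄ :+ b₅)) :=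
      x :* (v :+ (b₂ :- b₃)) :+ y :* (b₀ :- (v :+ (b₂ :- b₃)) :- b₄)
        :+ (v :+ (b₂ :- b₃) :+ (b₄ :- b₅) :- u₀))
    refl (seq r₀ i) (seq r₁ i) (U m) (β 0) (u 0)
      (β (suc m ℕ.* 2)) (β (1 ℕ.+ suc m ℕ.* 2))
      (β (suc (suc m) ℕ.* 2)) (β (1 ℕ.+ suc (suc m) ℕ.* 2))

  ∣T∣<½U : ∀ m → ∣ T m ∣ < fromℚ (½ ℚ.* U m)
  ∣T∣<½U zero    = <-respˡ-≗ ∣ d 0 ∣ ∣ T 0 ∣ (fromℚ (½ ℚ.* U 0))
    (λ i → cong ℚ.∣_∣ (d₀≗T₀ i)) (∣d∣<½u 0)
  ∣T∣<½U (suc m) = <-respˡ-≗ ∣ T m + d (suc m) ∣ ∣ T (suc m) ∣ (fromℚ (½ ℚ.* U (suc m)))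
    (λ i → cong ℚ.∣_∣ (T+d≗T m i))
    (<-≤-transℚ ∣ T m + d (suc m) ∣
      (∣x+y∣<z+w (T m) (d (suc m)) (fromℚ (½ ℚ.* U m)) (fromℚ (½ ℚ.* u (suc m)))
        (∣T∣<½U m) (∣d∣<½u (suc m)))
      (ℚ.≤-reflexive (sym (ℚ.*-distribˡ-+ ½ (U m) (u (suc m))))))

  ∣r₀-r₁+1∣<½ : ∀ {m} → Periodic (suc m) b → ∣ r₀ - r₁ + 1ℝ ∣ < ½ℝ
  ∣r₀-r₁+1∣<½ {m} per = ∣x∣-cancelʳ-< (r₀ - r₁ + 1ℝ) ½ (U m) (0<U m)
    (<-respˡ-≗ ∣ T m ∣ ∣ (r₀ - r₁ + 1ℝ) * fromℚ (U m) ∣ (fromℚ (½ ℚ.* U m))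
      (λ i → cong ℚ.∣_∣ (T≗ i)) (∣T∣<½U m))
    where
    -- The sum spans two periods, an even length whatever the parity of the period. Hence the
    -- boundary terms cancel: the coefficient of `r₁` becomes `- U m`, and `u (suc m)` equals `u 0`.
    twice : ∀ k → b (k ℕ.+ suc m ℕ.* 2) ≡ b k
    twice k = trans (cong (λ n → b (k ℕ.+ n)) (ℕ.*-comm (suc m) 2)) (periodic-* per 2 k)

    T≗ : ∀ i → seq (T m) i ≡ seq ((r₀ - r₁ + 1ℝ) * fromℚ (U m)) i
    T≗ i = trans
      (cong₂ (λ s t → seq r₀ i ℚ.* U m ℚ.+ seq r₁ i ℚ.* (β 0 ℚ.- U m ℚ.- s)
                        ℚ.+ (U m ℚ.+ (s ℚ.- t) ℚ.- u 0))
        (cong ι (twice 0)) (cong ι (twice 1)))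
      (solve 5 (λ x y v b₀ b₁ →
          x :* v :+ y :* (b₀ :- v :- b₀) :+ (v :+ (b₀ :- b₁) :- (b₀ :- b₁)) :=
          (x :- y :+ con 1ℚ) :* v)
        refl (seq r₀ i) (seq r₁ i) (U m) (β 0) (β 1))

-- The bound for cycles of alternating signs

alternating⇒∣r₀-r₁+1∣<½ : ∀ r₀ r₁ b {p} → IsOrbit (r₀ , r₁) b → Periodic (suc p) b →
  Alternating b → ∣ r₀ - r₁ + 1ℝ ∣ < ½ℝ
alternating⇒∣r₀-r₁+1∣<½ r₀ r₁ b orbit per alt with ℤ.<-cmp (b 0) 0ℤ
... | tri> _ _ 0<b₀ = PositiveStart.∣r₀-r₁+1∣<½ r₀ r₁ b orbit alt 0<b₀ per
... | tri≈ _ b₀≡0 _ =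
  contradiction (subst (λ k → k ℤ.* b 1 ℤ.< 0ℤ) b₀≡0 (alt 0)) (ℤ.<-irrefl refl)
-- Dropping a negative first term leaves an alternating periodic orbit that starts positive.
... | tri< b₀<0 _ _ = PositiveStart.∣r₀-r₁+1∣<½ r₀ r₁ (λ n → b (suc n))
  (λ n → orbit (suc n)) (λ n → alt (suc n)) (i*j<0∧i<0⇒0<j (alt 0) b₀<0)
  (λ n → per (suc n))

alternatingCycle⇒∣r₀-r₁+1∣<½ : ∀ r₀ r₁ {p} (c : Vec ℤ p) → IsCycle (r₀ , r₁) c →
  AlternatingSigns c → ∣ r₀ - r₁ + 1ℝ ∣ < ½ℝ
alternatingCycle⇒∣r₀-r₁+1∣<½ _ _ {zero} c (_ , _ , _ , (() , _) , _)
alternatingCycle⇒∣r₀-r₁+1∣<½ r₀ r₁ {suc p} c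
  (a , orbit , n₀ , (_ , per) , n , n₀≤n , c≡a) alt =
  alternating⇒∣r₀-r₁+1∣<½ r₀ r₁ b tail-orbit tail-periodic
    (alternatingSigns⇒alternating {b = b} c tail-periodic
      (λ i → trans (c≡a i) (cong a (ℕ.+-comm n (toℕ i)))) alt)
  where
  b : ℕ → ℤ
  -- With `m` on the left, `suc m + n` reduces, so the orbit property of the tail needs no
  -- transport.
  b m = a (m ℕ.+ n)

  tail-orbit : IsOrbit (r₀ , r₁) b
  tail-orbit m = orbit (m ℕ.+ n)

  tail-periodic : Periodic (suc p) b
  tail-periodic k = begin
    a (k ℕ.+ suc p ℕ.+ n)      ≡⟨ cong a (ℕ.+-assoc k (suc p) n) ⟩
    a (k ℕ.+ (suc p ℕ.+ n))    ≡⟨ cong (λ m → a (k ℕ.+ m)) (ℕ.+-comm (suc p) n) ⟩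
    a (k ℕ.+ (n ℕ.+ suc p))    ≡⟨ cong a (ℕ.+-assoc k n (suc p)) ⟨
    a (k ℕ.+ n ℕ.+ suc p)      ≡⟨ per (k ℕ.+ n) (ℕ.≤-trans n₀≤n (ℕ.m≤n+m n k)) ⟩
    a (k ℕ.+ n)                ∎
    where open ≡-Reasoning

-- Cycles of the form (t, -t)

[t,-t]-cycle⇒r₀-r₁+1≈0 : ∀ r₀ r₁ {t} → t ≢ 0ℤ → IsCycle (r₀ , r₁) (t ∷ ℤ.- t ∷ []) →
  r₀ - r₁ + 1ℝ ≈ 0ℝ
[t,-t]-cycle⇒r₀-r₁+1≈0 r₀ r₁ {t} t≢0 (a , orbit , n₀ , (_ , per) , n , n₀≤n , c≡a) ε 0<ε =
  Eventually-map (λ i (p , q) → close i p q)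
    (Eventually-∧ (fracPart-nonNeg (r₀ , r₁) a orbit n ε 0<ε)
      (fracPart-nonNeg (r₀ , r₁) a orbit (suc n) ε 0<ε))
  where
  τ : ℚ
  τ = ι t

  aₙ : ι (a n) ≡ τ
  aₙ = cong ι (trans (cong a (sym (ℕ.+-identityʳ n))) (sym (c≡a zero)))

  aₙ₊₁ : ι (a (1 ℕ.+ n)) ≡ ℚ.- τ
  aₙ₊₁ = trans (cong ι (trans (cong a (ℕ.+-comm 1 n)) (sym (c≡a (suc zero))))) (ι-neg t)

  aₙ₊₂ : ι (a (2 ℕ.+ n)) ≡ τ
  aₙ₊₂ = trans (cong ι (trans (cong a (ℕ.+-comm 2 n)) (per n n₀≤n))) aₙ

  aₙ₊₃ : ι (a (3 ℕ.+ n)) ≡ ℚ.- τ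
  aₙ₊₃ = trans
    (cong ι (trans (cong a (ℕ.+-comm 2 (1 ℕ.+ n))) (per (1 ℕ.+ n) (ℕ.m≤n⇒m≤1+n n₀≤n)))) aₙ₊₁

  D : ℝ
  D = r₀ - r₁ + 1ℝ

  fracPartₙ : ∀ i → seq (fracPart (r₀ , r₁) a n) i ≡ τ ℚ.* seq D i
  fracPartₙ i = begin
    x ℚ.* ι (a n) ℚ.+ y ℚ.* ι (a (1 ℕ.+ n)) ℚ.+ ι (a (2 ℕ.+ n))
      ≡⟨ cong₂ ℚ._+_ (cong₂ (λ s t → x ℚ.* s ℚ.+ y ℚ.* t) aₙ aₙ₊₁) aₙ₊₂ ⟩
    x ℚ.* τ ℚ.+ y ℚ.* ℚ.- τ ℚ.+ τ
      ≡⟨ solve 3 (λ x y t → x :* t :+ y :* (:- t) :+ t := t :* (x :- y :+ con 1ℚ)) refl x y τ ⟩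
    τ ℚ.* seq D i ∎
    where
    open ≡-Reasoning
    x = seq r₀ i
    y = seq r₁ i

  fracPartₙ₊₁ : ∀ i → seq (fracPart (r₀ , r₁) a (suc n)) i ≡ ℚ.- (τ ℚ.* seq D i)
  fracPartₙ₊₁ i = begin
    x ℚ.* ι (a (1 ℕ.+ n)) ℚ.+ y ℚ.* ι (a (2 ℕ.+ n)) ℚ.+ ι (a (3 ℕ.+ n))
      ≡⟨ cong₂ ℚ._+_ (cong₂ (λ s t → x ℚ.* s ℚ.+ y ℚ.* t) aₙ₊₁ aₙ₊₂) aₙ₊₃ ⟩
    x ℚ.* ℚ.- τ ℚ.+ y ℚ.* τ ℚ.- τ
      ≡⟨ solve 3 (λ x y t → x :* (:- t) :+ y :* t :- t := :- (t :* (x :- y :+ con 1ℚ)))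
           refl x y τ ⟩
    ℚ.- (τ ℚ.* seq D i) ∎
    where
    open ≡-Reasoning
    x = seq r₀ i
    y = seq r₁ i

  0<-p+ε⇒p<ε : ∀ {p} → 0ℚ ℚ.< ℚ.- p ℚ.+ ε → p ℚ.< ε
  0<-p+ε⇒p<ε {p} lt = subst₂ ℚ._<_ (ℚ.+-identityʳ p)
    (solve 2 (λ p e → p :+ (:- p :+ e) := e) refl p ε) (ℚ.+-monoʳ-< p lt)

  close : ∀ i → 0ℚ ℚ.< seq (fracPart (r₀ , r₁) a n) i ℚ.+ ε →
    0ℚ ℚ.< seq (fracPart (r₀ , r₁) a (suc n)) i ℚ.+ ε →
    ℚ.∣ seq D i ℚ.- 0ℚ ∣ ℚ.< ε
  close i pos₀ pos₁ = begin-strict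
    ℚ.∣ seq D i ℚ.- 0ℚ ∣        ≡⟨ cong ℚ.∣_∣ (ℚ.+-identityʳ (seq D i)) ⟩
    ℚ.∣ seq D i ∣               ≡⟨ ℚ.*-identityˡ _ ⟨
    1ℚ ℚ.* ℚ.∣ seq D i ∣
      -- A nonzero integer has absolute value at least 1, so multiplying by it replaces a division
      -- by `τ`. The two fractional parts, each above `- ε`, then bound `τ * D` from both sides.
      ≤⟨ ℚ.*-monoʳ-≤-nonNeg ℚ.∣ seq D i ∣ {{ℚ.∣-∣-nonNeg (seq D i)}} (1≤∣ι∣ t≢0) ⟩
    ℚ.∣ τ ∣ ℚ.* ℚ.∣ seq D i ∣   ≡⟨ ℚ.∣p*q∣≡∣p∣*∣q∣ τ (seq D i) ⟨
    ℚ.∣ τ ℚ.* seq D i ∣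
      <⟨ ∣∣-<ℚ
           (0<-p+ε⇒p<ε (subst (λ q → 0ℚ ℚ.< q ℚ.+ ε) (fracPartₙ₊₁ i) pos₁))
           (0<-p+ε⇒p<ε (subst (λ q → 0ℚ ℚ.< q ℚ.+ ε)
             (trans (fracPartₙ i) (solve 1 (λ a → a := :- (:- a)) refl _)) pos₀)) ⟩
    ε                           ∎
    where open ℚ.≤-Reasoning

-- The orbit 1, -1, 1, -1, ... on the line

alternate : ℕ → ℤ
alternate zero          = 1ℤ
alternate (suc zero)    = -1ℤ
-- The two-step recursion builds in period 2, so the orbit condition has to be checked only at the
-- first two indices.
alternate (suc (suc n)) = alternate n

alternate≢0 : ∀ n → alternate n ≢ 0ℤ
alternate≢0 zero          ()
alternate≢0 (suc zero)    ()
alternate≢0 (suc (suc n)) = alternate≢0 n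

alternate-periodicFrom : PeriodicFrom alternate 0 2
alternate-periodicFrom = ℕ.z<s , λ n _ → cong alternate (ℕ.+-comm n 2)

≈⇒isFloor : ∀ x k → x ≈ fromℤ k → IsFloor x k
≈⇒isFloor x k x≈k =
  (λ ε 0<ε → Eventually-map (λ i lt → subst₂ ℚ._<_
      (solve 2 (λ k x → :- (x :- k) :+ x := k) refl (ι k) (seq x i)) (ℚ.+-comm ε (seq x i))
      (ℚ.+-monoˡ-< (seq x i) (ℚ.≤-<-trans (-p≤∣p∣ (seq x i ℚ.- ι k)) lt)))
    (x≈k ε 0<ε)) ,
  -- Being within ½ of `k` leaves the other ½ below `k + 1` as the margin.
  ½ , ℚ.positive⁻¹ ½ , Eventually-map (λ i lt → subst₂ ℚ._<_
      (solve 2 (λ k x → x :- k :+ (k :+ con ½) := x :+ con ½) refl (ι k) (seq x i))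
      (solve 1 (λ k → con ½ :+ (k :+ con ½) := k :+ con 1ℚ) refl (ι k))
      (ℚ.+-monoˡ-< (ι k ℚ.+ ½) (ℚ.≤-<-trans (p≤∣p∣ (seq x i ℚ.- ι k)) lt)))
    (x≈k ½ (ℚ.positive⁻¹ ½))

-- With `D` for `r₀ - r₁ + 1`, the reals whose floors are taken are alternately `D - 1` and `1 - D`.
-- They equal the integers -1 and 1, so their floors are known.
alternate-orbit : ∀ r₀ r₁ → r₀ - r₁ + 1ℝ ≈ 0ℝ → IsOrbit (r₀ , r₁) alternate
alternate-orbit r₀ r₁ D≈0 zero = refl , -1ℤ ,
  ≈⇒isFloor (r₀ * fromℤ 1ℤ + r₁ * fromℤ -1ℤ) -1ℤ (λ ε 0<ε → Eventually-map
    (λ i → subst (ℚ._< ε) (cong ℚ.∣_∣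
      (solve 2 (λ x y → x :- y :+ con 1ℚ :- con 0ℚ :=
        x :* con 1ℚ :+ y :* con (ι -1ℤ) :- con (ι -1ℤ)) refl (seq r₀ i) (seq r₁ i))))
    (D≈0 ε 0<ε)) , refl
alternate-orbit r₀ r₁ D≈0 (suc zero) = refl , 1ℤ ,
  ≈⇒isFloor (r₀ * fromℤ -1ℤ + r₁ * fromℤ 1ℤ) 1ℤ (λ ε 0<ε → Eventually-map
    (λ i → subst (ℚ._< ε) (trans (sym (ℚ.∣-p∣≡∣p∣ (seq (r₀ - r₁ + 1ℝ) i ℚ.- 0ℚ))) (cong ℚ.∣_∣
      (solve 2 (λ x y → :- (x :- y :+ con 1ℚ :- con 0ℚ) :=
        x :* con (ι -1ℤ) :+ y :* con 1ℚ :- con 1ℚ) refl (seq r₀ i) (seq r₁ i)))))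
    (D≈0 ε 0<ε)) , refl
alternate-orbit r₀ r₁ D≈0 (suc (suc n)) = alternate-orbit r₀ r₁ D≈0 n

line⇒r₀-r₁+1≈0 : ∀ r₀ r₁ → Line (r₀ , r₁) → r₀ - r₁ + 1ℝ ≈ 0ℝ
-- The quantity is the error of `r₀` against `s` minus that of `r₁` against `s + 1`; each gets half
-- of `ε`.
line⇒r₀-r₁+1≈0 r₀ r₁ (s , r₀≈s , r₁≈s+1) ε 0<ε =
  Eventually-map (λ i (p , q) → begin-strict
    ℚ.∣ seq r₀ i ℚ.- seq r₁ i ℚ.+ 1ℚ ℚ.- 0ℚ ∣
      ≡⟨ cong ℚ.∣_∣ (solve 3 (λ x y s →
           x :- y :+ con 1ℚ :- con 0ℚ := x :- s :+ :- (y :- (s :+ con 1ℚ)))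
           refl (seq r₀ i) (seq r₁ i) (seq s i)) ⟩
    ℚ.∣ seq r₀ i ℚ.- seq s i ℚ.+ ℚ.- (seq r₁ i ℚ.- (seq s i ℚ.+ 1ℚ)) ∣
      ≤⟨ ℚ.∣p+q∣≤∣p∣+∣q∣ (seq r₀ i ℚ.- seq s i) _ ⟩
    ℚ.∣ seq r₀ i ℚ.- seq s i ∣ ℚ.+ ℚ.∣ ℚ.- (seq r₁ i ℚ.- (seq s i ℚ.+ 1ℚ)) ∣
      ≡⟨ cong (ℚ.∣ seq r₀ i ℚ.- seq s i ∣ ℚ.+_) (ℚ.∣-p∣≡∣p∣ (seq r₁ i ℚ.- (seq s i ℚ.+ 1ℚ))) ⟩
    ℚ.∣ seq r₀ i ℚ.- seq s i ∣ ℚ.+ ℚ.∣ seq r₁ i ℚ.- (seq s i ℚ.+ 1ℚ) ∣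
      <⟨ ℚ.+-mono-< p q ⟩
    ½ ℚ.* ε ℚ.+ ½ ℚ.* ε
      ≡⟨ solve 1 (λ e → con ½ :* e :+ con ½ :* e := e) refl ε ⟩
    ε ∎)
    (Eventually-∧ (r₀≈s (½ ℚ.* ε) (½*-positive 0<ε)) (r₁≈s+1 (½ ℚ.* ε) (½*-positive 0<ε)))
  where open ℚ.≤-Reasoning

lemma3 : (∀ r₀ r₁ →
    ((∃[ p ] ∃[ c ] IsCycle {p} (r₀ , r₁) c × AlternatingSigns c) →
    ∣ r₀ - r₁ + 1ℝ ∣ < ½ℝ)
    ×
    ((∃[ t ] t ≢ 0ℤ × IsCycle (r₀ , r₁) (t ∷ ℤ.- t ∷ [])) ⇔
    r₀ - r₁ + 1ℝ ≈ 0ℝ))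
    × Empty (Line ∩ D₂⁽*⁾)
lemma3 =
  (λ r₀ r₁ →
    (λ (_ , c , cycle , alt) → alternatingCycle⇒∣r₀-r₁+1∣<½ r₀ r₁ c cycle alt) ,
    mk⇔ (λ (_ , t≢0 , cycle) → [t,-t]-cycle⇒r₀-r₁+1≈0 r₀ r₁ t≢0 cycle)
        -- The value 1 for `t` suffices; the same never-vanishing periodic orbit gives the
        -- disjointness from `D₂⁽*⁾`.
        (λ D≈0 → 1ℤ , (λ ()) , alternate , alternate-orbit r₀ r₁ D≈0 , 0 , alternate-periodicFrom ,
          0 , ℕ.z≤n , λ { zero → refl ; (suc zero) → refl }))
  , λ (r₀ , r₁) (line , r∈D₂) →
    let (N , a≡0) = r∈D₂ alternate (alternate-orbit r₀ r₁ (line⇒r₀-r₁+1≈0 r₀ r₁ line))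
                      (0 , 2 , alternate-periodicFrom)
    in alternate≢0 N (a≡0 N ℕ.≤-refl)
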